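{- If $L$ is a Tr-lattice, then each element of $L$ has at most two covers in $L$.
   Context: All matroids and lattices are finite. A flat $X$ of a matroid $M$ is cyclic if $M|X$ has no isthmuses; the cyclic flats ordered by inclusion form a lattice $\mathcal{Z}(M)$. A lattice $L$ is a Tr-lattice if every matroid $M$ with $\mathcal{Z}(M)$ isomorphic to $L$ is transversal. An element $y$ covers $x$ if $x<y$ and there is no $z$ with $x<z<y$. -}

module Defs where

open import Level using (0ℓ)
open import Data.Nat as ℕ using (ℕ; suc)
open import Data.Fin using (Fin)
open import Data.Fin.Subset using (Subset; _∈_; _∉_; _⊆_; _∪_; _-_; ⁅_⁆; ∣_∣) renaming (⊥ to ∅)
open import Data.Product using (Σ; ∃; ∃-syntax; _×_)
open import Data.Empty using (⊥)
open import Relation.Nullary using (¬_)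
open import Relation.Binary using (Rel)
open import Relation.Binary.PropositionalEquality using (_≡_)
open import Relation.Binary.Lattice.Structures using (IsLattice)
open import Function.Bundles using (_⇔_)

record Matroid (m : ℕ) : Set₁ where
  field
    Indep        : Subset m → Set
    indep-empty  : Indep ∅
    indep-subset : ∀ {I J} → J ⊆ I → Indep I → Indep J
    augment      : ∀ {I J} → Indep I → Indep J → ∣ I ∣ ℕ.< ∣ J ∣ →
                   ∃[ e ] (e ∈ J × e ∉ I × Indep (I ∪ ⁅ e ⁆))

module _ {m : ℕ} (M : Matroid m) where
  open Matroid M

  IsRank : Subset m → ℕ → Set
  IsRank X k = (∃[ I ] (I ⊆ X × Indep I × ∣ I ∣ ≡ k)) ×
               (∀ J → J ⊆ X → Indep J → ∣ J ∣ ℕ.≤ k)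

  IsFlat : Subset m → Set
  IsFlat X = ∀ e → e ∉ X → ∀ k → IsRank X k → ¬ IsRank (X ∪ ⁅ e ⁆) k

  -- e is an isthmus (coloop) of the restriction M|X:
  -- e ∈ X and r(X - e) < r(X)  (ranks in M|X agree with ranks in M).
  IsIsthmusOfRestriction : Subset m → Fin m → Set
  IsIsthmusOfRestriction X e = e ∈ X × (∀ k → IsRank X k → ¬ IsRank (X - e) k)

  IsCyclicFlat : Subset m → Set
  IsCyclicFlat X = IsFlat X × (∀ e → ¬ IsIsthmusOfRestriction X e)

  IsPartialTransversal : {k : ℕ} → (Fin k → Subset m) → Subset m → Set
  IsPartialTransversal {k} A I =
    Σ ((e : Fin m) → e ∈ I → Fin k) λ φ →
      (∀ e (p : e ∈ I) → e ∈ A (φ e p)) ×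
      (∀ e e' (p : e ∈ I) (q : e' ∈ I) → φ e p ≡ φ e' q → e ≡ e')

  IsTransversal : Set
  IsTransversal = ∃[ k ] Σ (Fin k → Subset m) λ A →
    ∀ I → Indep I ⇔ IsPartialTransversal A I

-- Finite lattices: carrier Fin n (every finite lattice is isomorphic to one).

record FinLattice : Set₁ where
  field
    size      : ℕ
    _≤_       : Rel (Fin size) 0ℓ
    _∨_       : Fin size → Fin size → Fin size
    _∧_       : Fin size → Fin size → Fin size
    isLattice : IsLattice _≡_ _≤_ _∨_ _∧_

  Carrier : Set
  Carrier = Fin size

  _<_ : Rel Carrier 0ℓ
  x < y = x ≤ y × ¬ (x ≡ y)

  Covers : Carrier → Carrier → Set
  Covers x y = x < y × ¬ (∃[ z ] (x < z × z < y))

_≅Z_ : FinLattice → {m : ℕ} → Matroid m → Set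
L ≅Z M = Σ (FinLattice.Carrier L → Subset _) λ f →
  (∀ x → IsCyclicFlat M (f x)) ×
  (∀ X → IsCyclicFlat M X → ∃[ x ] (f x ≡ X)) ×
  (∀ x y → FinLattice._≤_ L x y ⇔ (f x ⊆ f y))

IsTrLattice : FinLattice → Set₁
IsTrLattice L = ∀ (m : ℕ) (M : Matroid m) → L ≅Z M → IsTransversal M

{-# OPTIONS --safe #-}

-- Suppose x has three distinct covers. Let d : L → ℕ be strictly decreasing and supermodular
-- with value K at the bottom, and put N = K + 1 elements in a block for each element of L. With
-- Z z the union of the blocks of the w ≤ z, the sets I with |I ∩ Z z| ≤ K - d z for all z are
-- the independent sets of a matroid whose cyclic flats are the Z z, of rank K - d z.
-- If it is transversal, with presentation A, then a cyclic flat F meets exactly r(F) of the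
-- sets of A, and counting these sets for the flats of the covers y₁, y₂, y₃ gives
-- d y₁ + d y₂ + d y₃ ≤ d x + d (y₁ ∨ y₂) + d (y₁ ∨ y₃) + d (y₂ ∨ y₃). This fails when d is
-- valued in powers of two, with d yᵢ = d x / 2 and d at most d x / 8 at the joins of two covers.

module Submission where

open import Defs
open import Level using (0ℓ)
open import Data.Empty using (⊥; ⊥-elim)
open import Data.Nat as ℕ using (ℕ; zero; suc; _+_; _*_; _^_; _≤_; _<_; z≤n; s≤s; _≤?_)
open import Data.Nat.Properties
open import Data.Nat.Induction using (<-wellFounded)
open import Data.Nat.Tactic.RingSolver using (solve-∀)
open import Data.Fin using (Fin; zero; suc; combine; quotient)
open import Data.Fin.Properties as Fin using (any?; all?; ¬∀⟶∃¬; remQuot-combine; combine-injectiveʳ)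
open import Data.Fin.Subset using (Subset; inside; outside; _∈_; _∉_; _⊆_; _∪_; _∩_; _-_; ∁; ⁅_⁆; ∣_∣) renaming (⊥ to ∅; ⊤ to full)
open import Data.Fin.Subset.Properties
open import Data.Product using (∃; ∃-syntax; _×_; _,_; proj₁; proj₂)
open import Data.Sum using (_⊎_; inj₁; inj₂; [_,_]′)
open import Data.Vec using ([]; _∷_; here; there; tabulate)
open import Data.Vec.Properties using (lookup∘tabulate; lookup⇒[]=; []=⇒lookup)
open import Data.Vec.Functional using (updateAt)
open import Data.Vec.Functional.Properties using (updateAt-updates; updateAt-minimal)
open import Function using (_∘_; id; const; case_of_; _⇔_; mk⇔; Equivalence)
open import Induction.WellFounded using (Acc; acc)
open import Relation.Nullary using (¬_; Dec; yes; no; does; contradiction; ¬?; _×-dec_)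
open import Relation.Nullary.Decidable using (dec-true; decidable-stable; map′)
open import Relation.Unary using (Pred; Decidable)
open import Relation.Binary using (Rel; Transitive)
open import Relation.Binary.Lattice.Structures using (IsLattice)
open import Relation.Binary.PropositionalEquality using (_≡_; _≢_; refl; sym; trans; cong; cong₂; subst)

private
  variable
    m n k : ℕ

-- Finite subsets

⟦_⟧ : {P : Pred (Fin n) 0ℓ} → Decidable P → Subset n
⟦ P? ⟧ = tabulate (λ x → does (P? x))

∈⟦⟧⁺ : {P : Pred (Fin n) 0ℓ} (P? : Decidable P) {x : Fin n} → P x → x ∈ ⟦ P? ⟧
∈⟦⟧⁺ P? {x} px = lookup⇒[]= x _ (trans (lookup∘tabulate _ x) (dec-true (P? x) px))

∈⟦⟧⁻ : {P : Pred (Fin n) 0ℓ} (P? : Decidable P) {x : Fin n} → x ∈ ⟦ P? ⟧ → P x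
∈⟦⟧⁻ P? {x} x∈ with P? x | trans (sym (lookup∘tabulate (λ y → does (P? y)) x)) ([]=⇒lookup x∈)
... | yes px | _ = px
... | no _   | ()

∣p∪q∣+∣p∩q∣≡∣p∣+∣q∣ : (p q : Subset n) → ∣ p ∪ q ∣ + ∣ p ∩ q ∣ ≡ ∣ p ∣ + ∣ q ∣
∣p∪q∣+∣p∩q∣≡∣p∣+∣q∣ []            []            = refl
∣p∪q∣+∣p∩q∣≡∣p∣+∣q∣ (outside ∷ p) (outside ∷ q) = ∣p∪q∣+∣p∩q∣≡∣p∣+∣q∣ p q
∣p∪q∣+∣p∩q∣≡∣p∣+∣q∣ (outside ∷ p) (inside ∷ q)  =
  trans (cong suc (∣p∪q∣+∣p∩q∣≡∣p∣+∣q∣ p q)) (sym (+-suc ∣ p ∣ ∣ q ∣))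
∣p∪q∣+∣p∩q∣≡∣p∣+∣q∣ (inside ∷ p)  (outside ∷ q) = cong suc (∣p∪q∣+∣p∩q∣≡∣p∣+∣q∣ p q)
∣p∪q∣+∣p∩q∣≡∣p∣+∣q∣ (inside ∷ p)  (inside ∷ q)  = cong suc
  (trans (+-suc ∣ p ∪ q ∣ ∣ p ∩ q ∣)
  (trans (cong suc (∣p∪q∣+∣p∩q∣≡∣p∣+∣q∣ p q)) (sym (+-suc ∣ p ∣ ∣ q ∣))))

∣p∣≡∣p∩q∣+∣p∩∁q∣ : (p q : Subset n) → ∣ p ∣ ≡ ∣ p ∩ q ∣ + ∣ p ∩ ∁ q ∣
∣p∣≡∣p∩q∣+∣p∩∁q∣ []            []            = refl
∣p∣≡∣p∩q∣+∣p∩∁q∣ (outside ∷ p) (_ ∷ q)       = ∣p∣≡∣p∩q∣+∣p∩∁q∣ p q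
∣p∣≡∣p∩q∣+∣p∩∁q∣ (inside ∷ p)  (inside ∷ q)  = cong suc (∣p∣≡∣p∩q∣+∣p∩∁q∣ p q)
∣p∣≡∣p∩q∣+∣p∩∁q∣ (inside ∷ p)  (outside ∷ q) =
  trans (cong suc (∣p∣≡∣p∩q∣+∣p∩∁q∣ p q)) (sym (+-suc ∣ p ∩ q ∣ ∣ p ∩ ∁ q ∣))

∣p∪⁅x⁆∣≤1+∣p∣ : (p : Subset n) (x : Fin n) → ∣ p ∪ ⁅ x ⁆ ∣ ≤ suc ∣ p ∣
∣p∪⁅x⁆∣≤1+∣p∣ p x = begin
  ∣ p ∪ ⁅ x ⁆ ∣                    ≤⟨ m≤m+n _ _ ⟩
  ∣ p ∪ ⁅ x ⁆ ∣ + ∣ p ∩ ⁅ x ⁆ ∣  ≡⟨ ∣p∪q∣+∣p∩q∣≡∣p∣+∣q∣ p ⁅ x ⁆ ⟩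
  ∣ p ∣ + ∣ ⁅ x ⁆ ∣               ≡⟨ cong (∣ p ∣ +_) (∣⁅x⁆∣≡1 x) ⟩
  ∣ p ∣ + 1                        ≡⟨ +-comm ∣ p ∣ 1 ⟩
  suc ∣ p ∣                        ∎
  where open ≤-Reasoning

x∉p⇒∣p∣<∣p∪⁅x⁆∣ : {p : Subset n} {x : Fin n} → x ∉ p → ∣ p ∣ < ∣ p ∪ ⁅ x ⁆ ∣
x∉p⇒∣p∣<∣p∪⁅x⁆∣ {p = p} {x} x∉p =
  p⊂q⇒∣p∣<∣q∣ (p⊆p∪q ⁅ x ⁆ , x , q⊆p∪q p ⁅ x ⁆ (x∈⁅x⁆ x) , x∉p)

x∉p-x : (p : Subset n) (x : Fin n) → x ∉ p - x
x∉p-x (_ ∷ p) (suc x) (there x∈) = x∉p-x p x x∈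

∪-lub : {p q r : Subset n} → p ⊆ r → q ⊆ r → p ∪ q ⊆ r
∪-lub {p = p} {q} p⊆r q⊆r x∈ = [ p⊆r , q⊆r ]′ (x∈p∪q⁻ p q x∈)

⁅x⁆⊆p : {p : Subset n} {x : Fin n} → x ∈ p → ⁅ x ⁆ ⊆ p
⁅x⁆⊆p {p = p} {x} x∈p y∈ = subst (_∈ p) (sym (x∈⁅y⁆⇒x≡y x y∈)) x∈p

∪⁅⁆-mono : {p q : Subset n} (x : Fin n) → p ⊆ q → p ∪ ⁅ x ⁆ ⊆ q ∪ ⁅ x ⁆
∪⁅⁆-mono {q = q} x p⊆q = ∪-lub (p⊆p∪q ⁅ x ⁆ ∘ p⊆q) (q⊆p∪q q ⁅ x ⁆)

∩-monoˡ : {p q : Subset n} (r : Subset n) → p ⊆ q → p ∩ r ⊆ q ∩ r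
∩-monoˡ {p = p} r p⊆q x∈ = let x∈p , x∈r = x∈p∩q⁻ p r x∈ in x∈p∩q⁺ (p⊆q x∈p , x∈r)

∩-monoʳ : {q r : Subset n} (p : Subset n) → q ⊆ r → p ∩ q ⊆ p ∩ r
∩-monoʳ {q = q} p q⊆r x∈ = let x∈p , x∈q = x∈p∩q⁻ p q x∈ in x∈p∩q⁺ (x∈p , q⊆r x∈q)

p⊆[p-x]∪⁅x⁆ : (p : Subset m) (x : Fin m) → p ⊆ (p - x) ∪ ⁅ x ⁆
p⊆[p-x]∪⁅x⁆ p x {y} y∈p with y Fin.≟ x
... | yes refl = q⊆p∪q (p - x) ⁅ x ⁆ (x∈⁅x⁆ x)
... | no y≢x   = p⊆p∪q ⁅ x ⁆ (x∈p∧x≢y⇒x∈p-y y∈p y≢x)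

p-x⊆p : (p : Subset m) (x : Fin m) → p - x ⊆ p
p-x⊆p p x = p─q⊆p p ⁅ x ⁆

-- Inclusion-exclusion for three sets, arranged so that all terms are positive. The triple
-- intersection has the form `(p ∩ r) ∩ (q ∩ r)` because it comes from the modular law for `p ∩ r`
-- and `q ∩ r`, whose union contains `(p ∪ q) ∩ r`.
∪∩-inequality : (p q r : Subset n) →
  ∣ p ∪ q ∣ + ∣ p ∪ r ∣ + ∣ q ∪ r ∣ + ∣ (p ∩ r) ∩ (q ∩ r) ∣ ≤ ∣ (p ∪ q) ∪ r ∣ + (∣ p ∣ + ∣ q ∣ + ∣ r ∣)
∪∩-inequality p q r = +-cancelˡ-≤ (∣ r ∣ + w) _ _ (begin
  (∣ r ∣ + w) + (∣ p ∪ q ∣ + ∣ p ∪ r ∣ + ∣ q ∪ r ∣ + j)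
    ≡⟨ regroup₁ (∣ r ∣) w (∣ p ∪ q ∣) (∣ p ∪ r ∣) (∣ q ∪ r ∣) j ⟩
  (∣ p ∪ q ∣ + ∣ r ∣) + (∣ p ∪ r ∣ + ∣ q ∪ r ∣ + (w + j))
    ≤⟨ +-monoʳ-≤ (∣ p ∪ q ∣ + ∣ r ∣) (+-monoʳ-≤ (∣ p ∪ r ∣ + ∣ q ∪ r ∣) (≤-trans (+-monoˡ-≤ j (p⊆q⇒∣p∣≤∣q∣ distrib))
         (≤-reflexive (∣p∪q∣+∣p∩q∣≡∣p∣+∣q∣ (p ∩ r) (q ∩ r))))) ⟩
  (∣ p ∪ q ∣ + ∣ r ∣) + (∣ p ∪ r ∣ + ∣ q ∪ r ∣ + (∣ p ∩ r ∣ + ∣ q ∩ r ∣))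
    ≡⟨ cong ((∣ p ∪ q ∣ + ∣ r ∣) +_) (regroup₂ (∣ p ∪ r ∣) (∣ q ∪ r ∣) (∣ p ∩ r ∣) (∣ q ∩ r ∣)) ⟩
  (∣ p ∪ q ∣ + ∣ r ∣) + ((∣ p ∪ r ∣ + ∣ p ∩ r ∣) + (∣ q ∪ r ∣ + ∣ q ∩ r ∣))
    ≡⟨ cong₂ _+_ (sym (∣p∪q∣+∣p∩q∣≡∣p∣+∣q∣ (p ∪ q) r))
         (cong₂ _+_ (∣p∪q∣+∣p∩q∣≡∣p∣+∣q∣ p r) (∣p∪q∣+∣p∩q∣≡∣p∣+∣q∣ q r)) ⟩
  (∣ (p ∪ q) ∪ r ∣ + w) + ((∣ p ∣ + ∣ r ∣) + (∣ q ∣ + ∣ r ∣))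
    ≡⟨ regroup₃ (∣ (p ∪ q) ∪ r ∣) w (∣ p ∣) (∣ r ∣) (∣ q ∣) ⟩
  (∣ r ∣ + w) + (∣ (p ∪ q) ∪ r ∣ + (∣ p ∣ + ∣ q ∣ + ∣ r ∣)) ∎)
  where
  open ≤-Reasoning
  w = ∣ (p ∪ q) ∩ r ∣
  j = ∣ (p ∩ r) ∩ (q ∩ r) ∣

  distrib : (p ∪ q) ∩ r ⊆ (p ∩ r) ∪ (q ∩ r)
  distrib x∈ = ⊆-reflexive (∩-distribʳ-∪ r p q) x∈

  regroup₁ : ∀ a b c e f g → (a + b) + (c + e + f + g) ≡ (c + a) + (e + f + (b + g))
  regroup₁ = solve-∀

  regroup₂ : ∀ a b c e → a + b + (c + e) ≡ (a + c) + (b + e)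
  regroup₂ = solve-∀

  regroup₃ : ∀ a b c e f → (a + b) + ((c + e) + (f + e)) ≡ (e + b) + (a + (c + f + e))
  regroup₃ = solve-∀

-- Induction on `p`, deleting the image of its first element from `q`. The map is defined on members
-- only, as in a partial transversal.
injection⇒∣p∣≤∣q∣ : (p : Subset m) (q : Subset n) (f : ∀ x → x ∈ p → Fin n) →
                    (∀ x x∈p → f x x∈p ∈ q) →
                    (∀ x y x∈p y∈p → f x x∈p ≡ f y y∈p → x ≡ y) → ∣ p ∣ ≤ ∣ q ∣
injection⇒∣p∣≤∣q∣ []            q f f∈ inj = z≤n
injection⇒∣p∣≤∣q∣ (outside ∷ p) q f f∈ inj =
  injection⇒∣p∣≤∣q∣ p q (λ x x∈ → f (suc x) (there x∈)) (λ x x∈ → f∈ (suc x) (there x∈))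
    λ x y x∈ y∈ eq → Fin.suc-injective (inj (suc x) (suc y) (there x∈) (there y∈) eq)
injection⇒∣p∣≤∣q∣ (inside ∷ p)  q f f∈ inj = ≤-<-trans
  (injection⇒∣p∣≤∣q∣ p (q - f zero here) (λ x x∈ → f (suc x) (there x∈))
    (λ x x∈ → x∈p∧x≢y⇒x∈p-y (f∈ (suc x) (there x∈))
      λ eq → case inj (suc x) zero (there x∈) here eq of λ ())
    λ x y x∈ y∈ eq → Fin.suc-injective (inj (suc x) (suc y) (there x∈) (there y∈) eq))
  (x∈p⇒∣p-x∣<∣p∣ (f∈ zero here))

-- Matchings in bipartite graphs

-- `to` is total, but only its values on `I` are constrained: restriction keeps the function, and
-- rerouting changes it at one vertex.
record Matching (E : Fin m → Fin k → Set) (I : Subset m) : Set where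
  field
    to  : Fin m → Fin k
    adj : ∀ {e} → e ∈ I → E e (to e)
    inj : ∀ {e f} → e ∈ I → f ∈ I → to e ≡ to f → e ≡ f

open Matching

restrict : {E : Fin m → Fin k → Set} {I J : Subset m} → J ⊆ I → Matching E I → Matching E J
restrict J⊆I φ = record
  { to = to φ ; adj = adj φ ∘ J⊆I ; inj = λ e∈ f∈ → inj φ (J⊆I e∈) (J⊆I f∈) }

relax : {E E′ : Fin m → Fin k → Set} {I : Subset m} (φ : Matching E I) →
        (∀ {e} → e ∈ I → E′ e (to φ e)) → Matching E′ I
relax φ adj′ = record { to = to φ ; adj = adj′ ; inj = inj φ }

assign : {E : Fin m → Fin k → Set} {I : Subset m} (φ : Matching E I) (j : Fin m) (i : Fin k) →
         E j i → (∀ {e} → e ∈ I → to φ e ≢ i) → Matching E (I ∪ ⁅ j ⁆)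
assign {m = m} {k = k} {E = E} {I} φ j i Eji i∉φ = record { to = to′ ; adj = adj′ ; inj = inj′ }
  where
  to′ : Fin m → Fin k
  to′ = updateAt (to φ) j (const i)

  at : to′ j ≡ i
  at = updateAt-updates j (to φ)

  off : ∀ {e} → e ≢ j → to′ e ≡ to φ e
  off e≢j = updateAt-minimal _ j (to φ) e≢j

  old : ∀ {e} → e ∈ I ∪ ⁅ j ⁆ → e ≢ j → e ∈ I
  old e∈ e≢j with x∈p∪q⁻ I ⁅ j ⁆ e∈
  ... | inj₁ e∈I = e∈I
  ... | inj₂ e∈j = contradiction (x∈⁅y⁆⇒x≡y j e∈j) e≢j

  adj′ : ∀ {e} → e ∈ I ∪ ⁅ j ⁆ → E e (to′ e)
  adj′ {e} e∈ with e Fin.≟ j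
  ... | yes refl = subst (E j) (sym at) Eji
  ... | no e≢j   = subst (E e) (sym (off e≢j)) (adj φ (old e∈ e≢j))

  inj′ : ∀ {e f} → e ∈ I ∪ ⁅ j ⁆ → f ∈ I ∪ ⁅ j ⁆ → to′ e ≡ to′ f → e ≡ f
  inj′ {e} {f} e∈ f∈ eq with e Fin.≟ j | f Fin.≟ j
  ... | yes refl | yes refl = refl
  ... | yes refl | no f≢j   = contradiction (trans (sym (off f≢j)) (trans (sym eq) at)) (i∉φ (old f∈ f≢j))
  ... | no e≢j   | yes refl = contradiction (trans (sym (off e≢j)) (trans eq at)) (i∉φ (old e∈ e≢j))
  ... | no e≢j   | no f≢j   =
    inj φ (old e∈ e≢j) (old f∈ f≢j) (trans (sym (off e≢j)) (trans eq (off f≢j)))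

module _ {E : Fin m → Fin k → Set} {I J : Subset m} (ψ : Matching E J) where

  Disagree? : (φ : Matching E I) → Decidable (λ e → e ∈ J × to φ e ≢ to ψ e)
  Disagree? φ e = e ∈? J ×-dec ¬? (to φ e Fin.≟ to ψ e)

  -- Otherwise every index that `ψ` uses on `J` is used by `φ` on `I`, and choosing the elements
  -- that use them injects `J` into `I`.
  ψ-covers-more : (φ : Matching E I) → ∣ I ∣ < ∣ J ∣ →
                  ∃[ j ] (j ∈ J × ∀ {e} → e ∈ I → to φ e ≢ to ψ j)
  ψ-covers-more φ I<J
    with any? (λ j → j ∈? J ×-dec ¬? (any? (λ e → e ∈? I ×-dec (to φ e Fin.≟ to ψ j))))
  ... | yes (j , j∈J , unused) = j , j∈J , λ e∈I eq → unused (_ , e∈I , eq)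
  ... | no allUsed = contradiction I<J (≤⇒≯ (injection⇒∣p∣≤∣q∣ J I
          (λ j j∈J → proj₁ (used j j∈J))
          (λ j j∈J → proj₁ (proj₂ (used j j∈J)))
          λ j j′ j∈J j′∈J eq → inj ψ j∈J j′∈J
            (trans (sym (proj₂ (proj₂ (used j j∈J))))
            (trans (cong (to φ) eq) (proj₂ (proj₂ (used j′ j′∈J)))))))
    where
    used : ∀ j → j ∈ J → ∃[ e ] (e ∈ I × to φ e ≡ to ψ j)
    used j j∈J = decidable-stable (any? λ e → e ∈? I ×-dec (to φ e Fin.≟ to ψ j))
      λ unused → allUsed (j , j∈J , unused)

  -- If an index used by ψ but not by φ belongs to an element already matched by φ, rerouting
  -- that element makes φ agree with ψ at one more place.
  augment-acc : (φ : Matching E I) → Acc _<_ ∣ ⟦ Disagree? φ ⟧ ∣ → ∣ I ∣ < ∣ J ∣ →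
                ∃[ j ] (j ∈ J × j ∉ I × Matching E (I ∪ ⁅ j ⁆))
  augment-acc φ (acc rec) I<J = go (ψ-covers-more φ I<J)
    where
    go : ∃[ j ] (j ∈ J × ∀ {e} → e ∈ I → to φ e ≢ to ψ j) →
         ∃[ j ] (j ∈ J × j ∉ I × Matching E (I ∪ ⁅ j ⁆))
    go (j , j∈J , unused) with j ∈? I
    ... | no j∉I  = j , j∈J , j∉I , assign φ j (to ψ j) (adj ψ j∈J) unused
    ... | yes j∈I = augment-acc φ′ (rec (p⊂q⇒∣p∣<∣q∣ (shrink , j , j∈D , j∉D′))) I<J
      where
      φ′ : Matching E I
      φ′ = restrict (p⊆p∪q ⁅ j ⁆) (assign φ j (to ψ j) (adj ψ j∈J) unused)

      agree : to φ′ j ≡ to ψ j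
      agree = updateAt-updates j (to φ)

      j∈D : j ∈ ⟦ Disagree? φ ⟧
      j∈D = ∈⟦⟧⁺ (Disagree? φ) (j∈J , unused j∈I)

      j∉D′ : j ∉ ⟦ Disagree? φ′ ⟧
      j∉D′ j∈D′ = proj₂ (∈⟦⟧⁻ (Disagree? φ′) j∈D′) agree

      shrink : ⟦ Disagree? φ′ ⟧ ⊆ ⟦ Disagree? φ ⟧
      shrink {e} e∈D′ with e Fin.≟ j
      ... | yes refl = j∈D
      ... | no e≢j   = let e∈J , differ = ∈⟦⟧⁻ (Disagree? φ′) e∈D′ in
        ∈⟦⟧⁺ (Disagree? φ) (e∈J , λ eq → differ (trans (updateAt-minimal e j (to φ) e≢j) eq))

  augment-matching : Matching E I → ∣ I ∣ < ∣ J ∣ →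
                     ∃[ j ] (j ∈ J × j ∉ I × Matching E (I ∪ ⁅ j ⁆))
  augment-matching φ = augment-acc φ (<-wellFounded _)

-- Suppose i ∈ N is not used by the matching of a basis I. A set of r elements of F that is
-- matched without i contains all neighbours of i, for otherwise i would extend it. Let e be
-- a neighbour of i and J a basis avoiding e. If i is matched to f in J, augment J - f from I
-- without using i: the single new element would have to be both e and f.
cyclic⇒neighbours≤rank :
  (E : Fin m → Fin k → Set) (F : Subset m) (N : Subset k) (r : ℕ) →
  (∀ {i} → i ∈ N → ∃[ e ] (e ∈ F × E e i)) →
  (∃[ J ] (J ⊆ F × Matching E J × ∣ J ∣ ≡ r)) →
  (∀ e → e ∈ F → ∃[ J ] (J ⊆ F × e ∉ J × Matching E J × ∣ J ∣ ≡ r)) →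
  (∀ J → J ⊆ F → Matching E J → ∣ J ∣ ≤ r) →
  ∣ N ∣ ≤ r
cyclic⇒neighbours≤rank {m = m} {k = k} E F N r nbr (I , I⊆F , φ , ∣I∣≡r) avoid bound
  with any? (λ i → i ∈? N ×-dec ¬? (any? λ e → e ∈? I ×-dec (to φ e Fin.≟ i)))
... | no allUsed = ≤-trans (injection⇒∣p∣≤∣q∣ N I
        (λ i i∈N → proj₁ (used i i∈N))
        (λ i i∈N → proj₁ (proj₂ (used i i∈N)))
        λ i j i∈N j∈N eq → trans (sym (proj₂ (proj₂ (used i i∈N))))
          (trans (cong (to φ) eq) (proj₂ (proj₂ (used j j∈N))))) (≤-reflexive ∣I∣≡r)
  where
  used : ∀ i → i ∈ N → ∃[ e ] (e ∈ I × to φ e ≡ i)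
  used i i∈N = decidable-stable (any? λ e → e ∈? I ×-dec (to φ e Fin.≟ i))
    λ unused → allUsed (i , i∈N , unused)
... | yes (i , i∈N , unused) = contradiction-at (avoid e e∈F)
  where
  e = proj₁ (nbr i∈N)
  e∈F = proj₁ (proj₂ (nbr i∈N))
  Eei = proj₂ (proj₂ (nbr i∈N))

  E′ : Fin m → Fin k → Set
  E′ f j = E f j × j ≢ i

  φ′ : Matching E′ I
  φ′ = relax φ λ f∈I → adj φ f∈I , λ eq → unused (_ , f∈I , eq)

  contains-nbrs : ∀ {J f} → J ⊆ F → Matching E′ J → ∣ J ∣ ≡ r → f ∈ F → E f i → f ∈ J
  contains-nbrs {J} {f} J⊆F χ ∣J∣≡r f∈F Efi = decidable-stable (f ∈? J) λ f∉J →
    contradiction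
      (bound (J ∪ ⁅ f ⁆) (∪-lub J⊆F (⁅x⁆⊆p f∈F))
        (assign (relax χ (proj₁ ∘ adj χ)) f i Efi λ g∈J → proj₂ (adj χ g∈J)))
      (<⇒≱ (subst (_< ∣ J ∪ ⁅ f ⁆ ∣) ∣J∣≡r (x∉p⇒∣p∣<∣p∪⁅x⁆∣ f∉J)))

  contradiction-at : ∃[ J ] (J ⊆ F × e ∉ J × Matching E J × ∣ J ∣ ≡ r) → ∣ N ∣ ≤ r
  contradiction-at (J , J⊆F , e∉J , ψ , ∣J∣≡r) with any? (λ f → f ∈? J ×-dec (to ψ f Fin.≟ i))
  ... | no i∉ψ = contradiction
          (contains-nbrs J⊆F (relax ψ λ f∈J → adj ψ f∈J , λ eq → i∉ψ (_ , f∈J , eq)) ∣J∣≡r e∈F Eei)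
          e∉J
  ... | yes (f , f∈J , ψf≡i) = contradiction (subst (_∈ J) (sym e≡f) f∈J) e∉J
    where
    J₀ = J - f

    J₀⊆J : J₀ ⊆ J
    J₀⊆J = p-x⊆p J f

    ψ₀ : Matching E′ J₀
    ψ₀ = relax (restrict J₀⊆J ψ) λ {h} h∈J₀ → adj ψ (J₀⊆J h∈J₀) ,
      λ eq → x∉p-x J f (subst (_∈ J₀) (inj ψ (J₀⊆J h∈J₀) f∈J (trans eq (sym ψf≡i))) h∈J₀)

    J₀<J : ∣ J₀ ∣ < ∣ J ∣
    J₀<J = x∈p⇒∣p-x∣<∣p∣ f∈J

    aug = augment-matching φ′ ψ₀ (subst (∣ J₀ ∣ <_) (trans ∣J∣≡r (sym ∣I∣≡r)) J₀<J)
    g = proj₁ aug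
    K = J₀ ∪ ⁅ g ⁆

    K⊆F : K ⊆ F
    K⊆F = ∪-lub (J⊆F ∘ J₀⊆J) (⁅x⁆⊆p (I⊆F (proj₁ (proj₂ aug))))

    ∣K∣≡r : ∣ K ∣ ≡ r
    ∣K∣≡r = trans (≤-antisym
      (≤-trans (∣p∪⁅x⁆∣≤1+∣p∣ J₀ g) J₀<J)
      (≤-trans (p⊆q⇒∣p∣≤∣q∣ (p⊆[p-x]∪⁅x⁆ J f)) (≤-trans (∣p∪⁅x⁆∣≤1+∣p∣ J₀ f)
        (x∉p⇒∣p∣<∣p∪⁅x⁆∣ (proj₁ (proj₂ (proj₂ aug))))))) ∣J∣≡r

    in-K : ∀ {h} → h ∈ F → E h i → h ∈ K
    in-K = contains-nbrs K⊆F (proj₂ (proj₂ (proj₂ aug))) ∣K∣≡r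

    is-g : ∀ {h} → h ∈ K → h ∉ J₀ → h ≡ g
    is-g h∈K h∉J₀ with x∈p∪q⁻ J₀ ⁅ g ⁆ h∈K
    ... | inj₁ h∈J₀ = contradiction h∈J₀ h∉J₀
    ... | inj₂ h∈g  = x∈⁅y⁆⇒x≡y g h∈g

    e≡f : e ≡ f
    e≡f = trans (is-g (in-K e∈F Eei) (e∉J ∘ J₀⊆J))
      (sym (is-g (in-K (J⊆F f∈J) (subst (E f) ψf≡i (adj ψ f∈J))) (x∉p-x J f)))

-- The matroid of a supermodular function on a lattice

-- Joins a starting element with all listed elements that satisfy `P`. As the order is arbitrary,
-- this gives the greatest tight element, the top and, with the order reversed, the bottom of a
-- lattice.
closed⇒greatest : {A : Set} {_≲_ : Rel A 0ℓ} (_∙_ : A → A → A) → Transitive _≲_ →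
  (∀ a b → a ≲ (a ∙ b)) → (∀ a b → b ≲ (a ∙ b)) →
  {P : Pred A 0ℓ} → Decidable P → (∀ {a b} → P a → P b → P (a ∙ b)) → ∃ P →
  (f : Fin n → A) → ∃[ t ] (P t × ∀ i → P (f i) → f i ≲ t)
closed⇒greatest {n = zero}  _∙_ tr l r P? cl (a , pa) f = a , pa , λ ()
closed⇒greatest {n = suc n} {_≲_ = _≲_} _∙_ tr l r {P} P? cl start f
  with closed⇒greatest _∙_ tr l r P? cl start (f ∘ suc) | P? (f zero)
... | t , pt , ub | no ¬p = t , pt , λ { zero p → contradiction p ¬p ; (suc i) → ub i }
... | t , pt , ub | yes p = f zero ∙ t , cl p pt ,
  λ { zero _ → l (f zero) t ; (suc i) q → tr (ub i q) (r (f zero) t) }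

module Order (L : FinLattice) where
  open FinLattice L public using (size; Carrier; _∨_; _∧_; Covers)
    renaming (_≤_ to _⊑_; _<_ to _⊏_)
  open IsLattice (FinLattice.isLattice L) public
    using (x≤x∨y; y≤x∨y; ∨-least; x∧y≤x; x∧y≤y; ∧-greatest)
    renaming (refl to ⊑-refl; trans to ⊑-trans; antisym to ⊑-antisym)

  -- Decidability comes from the lattice structure: `z ⊑ w` holds exactly when `z ∨ w ≡ w`, an
  -- equation in `Fin size`.
  _⊑?_ : ∀ z w → Dec (z ⊑ w)
  z ⊑? w with (z ∨ w) Fin.≟ w
  ... | yes eq = yes (subst (z ⊑_) eq (x≤x∨y z w))
  ... | no neq = no λ z⊑w → neq (⊑-antisym (∨-least z⊑w ⊑-refl) (y≤x∨y z w))

  _⊏?_ : ∀ z w → Dec (z ⊏ w)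
  z ⊏? w = z ⊑? w ×-dec ¬? (z Fin.≟ w)

  ⊏-⊑-trans : ∀ {z w v} → z ⊏ w → w ⊑ v → z ⊏ v
  ⊏-⊑-trans (z⊑w , z≢w) w⊑v = ⊑-trans z⊑w w⊑v ,
    λ { refl → z≢w (⊑-antisym z⊑w w⊑v) }

  minimum : Carrier → ∃[ b ] (∀ z → b ⊑ z)
  minimum x with closed⇒greatest {_≲_ = λ a b → b ⊑ a} _∧_ (λ p q → ⊑-trans q p) x∧y≤x x∧y≤y
                   {P = λ a → a ≡ a} (λ _ → yes refl) (λ _ _ → refl) (x , refl) id
  ... | b , _ , lb = b , λ z → lb z refl

module Construction (L : FinLattice)
  (d : Order.Carrier L → ℕ)
  (d-supermodular : ∀ z w → d z + d w ≤ d (Order._∧_ L z w) + d (Order._∨_ L z w))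
  (d-strict : ∀ {z w} → Order._⊏_ L z w → d w < d z)
  (d-pos : ∀ z → 0 < d z)
  (bot : Order.Carrier L) (bot⊑ : ∀ z → Order._⊑_ L bot z)
  where

  open Order L

  -- Independent sets will have fewer than `K` elements, so a block of `K + 1` elements does not fit
  -- into an independent set with one element added.
  K N ground : ℕ
  K = d bot
  N = suc K
  ground = size * N

  d-antitone : ∀ {z w} → z ⊑ w → d w ≤ d z
  d-antitone {z} {w} z⊑w with z Fin.≟ w
  ... | yes refl = ≤-refl
  ... | no z≢w   = <⇒≤ (d-strict (z⊑w , z≢w))

  block : Fin ground → Carrier
  block = quotient N

  point : Carrier → Fin N → Fin ground
  point = combine

  block-point : ∀ z j → block (point z j) ≡ z
  block-point z j = cong proj₁ (remQuot-combine z j)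

  abstract
    Z : Carrier → Subset ground
    Z z = ⟦ (λ e → block e ⊑? z) ⟧

    Z⁺ : ∀ {z e} → block e ⊑ z → e ∈ Z z
    Z⁺ {z} = ∈⟦⟧⁺ (λ e → block e ⊑? z)

    Z⁻ : ∀ {z e} → e ∈ Z z → block e ⊑ z
    Z⁻ {z} = ∈⟦⟧⁻ (λ e → block e ⊑? z)

  point∈Z : ∀ z j → point z j ∈ Z z
  point∈Z z j = Z⁺ (subst (_⊑ z) (sym (block-point z j)) ⊑-refl)

  point∈Z⁻ : ∀ {z w} j → point z j ∈ Z w → z ⊑ w
  point∈Z⁻ {z} {w} j p∈ = subst (_⊑ w) (block-point z j) (Z⁻ p∈)

  Z-mono : ∀ {z w} → z ⊑ w → Z z ⊆ Z w
  Z-mono z⊑w e∈ = Z⁺ (⊑-trans (Z⁻ e∈) z⊑w)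

  Z-cancel : ∀ {z w} → Z z ⊆ Z w → z ⊑ w
  Z-cancel {z} Zz⊆Zw = point∈Z⁻ zero (Zz⊆Zw (point∈Z z zero))

  block⊆⇒N≤ : ∀ z {A} → (∀ j → point z j ∈ A) → N ≤ ∣ A ∣
  block⊆⇒N≤ z {A} all∈ = subst (_≤ ∣ A ∣) (∣⊤∣≡n N)
    (injection⇒∣p∣≤∣q∣ full A (λ j _ → point z j) (λ j _ → all∈ j)
      λ i j _ _ → combine-injectiveʳ z i z j)

  -- The constraint that `I` meets `Z z` in at most `K - d z` elements, written without subtraction.
  record Indep (I : Subset ground) : Set where
    constructor indep
    field bound : ∀ z → ∣ I ∩ Z z ∣ + d z ≤ K

  open Indep

  Indep? : Decidable Indep
  Indep? I = map′ indep bound (all? λ z → ∣ I ∩ Z z ∣ + d z ≤? K)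

  Tight : Subset ground → Carrier → Set
  Tight I z = ∣ I ∩ Z z ∣ + d z ≡ K

  indep-subset : ∀ {I J} → J ⊆ I → Indep I → Indep J
  indep-subset J⊆I indI = indep λ z → ≤-trans (+-monoˡ-≤ (d z) (p⊆q⇒∣p∣≤∣q∣ (∩-monoˡ (Z z) J⊆I))) (bound indI z)

  indep-empty : Indep ∅
  indep-empty = indep λ z → ≤-trans
    (+-monoˡ-≤ (d z) (≤-trans (∣p∩q∣≤∣p∣ ∅ (Z z)) (≤-reflexive (∣⊥∣≡0 ground))))
    (d-antitone (bot⊑ z))

  -- As `K` is `d bot`, the flat `Z bot` has rank 0. So every independent set has a tight element
  -- from which joins can start.
  tight-bot : ∀ {I} → Indep I → Tight I bot
  tight-bot {I} indI = ≤-antisym (bound indI bot) (m≤n+m K ∣ I ∩ Z bot ∣)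

  count-modular : ∀ I z w → ∣ I ∩ Z z ∣ + ∣ I ∩ Z w ∣ ≤ ∣ I ∩ Z (z ∧ w) ∣ + ∣ I ∩ Z (z ∨ w) ∣
  count-modular I z w = begin
    ∣ I ∩ Z z ∣ + ∣ I ∩ Z w ∣                                      ≡⟨ ∣p∪q∣+∣p∩q∣≡∣p∣+∣q∣ (I ∩ Z z) (I ∩ Z w) ⟨
    ∣ (I ∩ Z z) ∪ (I ∩ Z w) ∣ + ∣ (I ∩ Z z) ∩ (I ∩ Z w) ∣         ≤⟨ +-mono-≤ (p⊆q⇒∣p∣≤∣q∣ union) (p⊆q⇒∣p∣≤∣q∣ inter) ⟩
    ∣ I ∩ Z (z ∨ w) ∣ + ∣ I ∩ Z (z ∧ w) ∣                          ≡⟨ +-comm ∣ I ∩ Z (z ∨ w) ∣ _ ⟩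
    ∣ I ∩ Z (z ∧ w) ∣ + ∣ I ∩ Z (z ∨ w) ∣                          ∎
    where
    open ≤-Reasoning
    union : (I ∩ Z z) ∪ (I ∩ Z w) ⊆ I ∩ Z (z ∨ w)
    union = ∪-lub (∩-monoʳ I (Z-mono (x≤x∨y z w))) (∩-monoʳ I (Z-mono (y≤x∨y z w)))
    inter : (I ∩ Z z) ∩ (I ∩ Z w) ⊆ I ∩ Z (z ∧ w)
    inter e∈ with x∈p∩q⁻ (I ∩ Z z) (I ∩ Z w) e∈
    ... | e∈z , e∈w = x∈p∩q⁺ (proj₁ (x∈p∩q⁻ I (Z z) e∈z) ,
      Z⁺ (∧-greatest (Z⁻ (proj₂ (x∈p∩q⁻ I (Z z) e∈z))) (Z⁻ (proj₂ (x∈p∩q⁻ I (Z w) e∈w)))))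

  -- Uncrossing: the values `∣ I ∩ Z v ∣ + d v` at the meet and the join sum to at least `K + K`,
  -- and the one at the meet is at most `K`.
  tight-∨ : ∀ {I} → Indep I → ∀ {z w} → Tight I z → Tight I w → Tight I (z ∨ w)
  tight-∨ {I} indI {z} {w} tz tw = ≤-antisym (bound indI (z ∨ w)) (+-cancelˡ-≤ K _ _ (begin
    K + K                                     ≡⟨ cong₂ _+_ tz tw ⟨
    (c z + d z) + (c w + d w)                 ≡⟨ interchange (c z) (d z) (c w) (d w) ⟩
    (c z + c w) + (d z + d w)                 ≤⟨ +-mono-≤ (count-modular I z w) (d-supermodular z w) ⟩
    (c (z ∧ w) + c (z ∨ w)) + (d (z ∧ w) + d (z ∨ w))
                                              ≡⟨ interchange (c (z ∧ w)) (d (z ∧ w)) (c (z ∨ w)) (d (z ∨ w)) ⟨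
    (c (z ∧ w) + d (z ∧ w)) + (c (z ∨ w) + d (z ∨ w))
                                              ≤⟨ +-monoˡ-≤ _ (bound indI (z ∧ w)) ⟩
    K + (c (z ∨ w) + d (z ∨ w))               ∎))
    where
    open ≤-Reasoning
    c : Carrier → ℕ
    c v = ∣ I ∩ Z v ∣
    interchange : ∀ a b e f → (a + b) + (e + f) ≡ (a + e) + (b + f)
    interchange = solve-∀

  -- A constraint violated after adding `e` must involve `e`, and since its count grows by at most
  -- one it was tight before.
  dependent⇒tight : ∀ {I e} → Indep I → ¬ Indep (I ∪ ⁅ e ⁆) → ∃[ z ] (Tight I z × e ∈ Z z)
  dependent⇒tight {I} {e} indI dep
    with ¬∀⟶∃¬ size _ (λ z → ∣ (I ∪ ⁅ e ⁆) ∩ Z z ∣ + d z ≤? K) (dep ∘ indep)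
  ... | z , exceeds with e ∈? Z z
  ...   | no e∉Z = contradiction
            (≤-trans (+-monoˡ-≤ (d z) (p⊆q⇒∣p∣≤∣q∣ drop-e)) (bound indI z)) exceeds
    where
    drop-e : (I ∪ ⁅ e ⁆) ∩ Z z ⊆ I ∩ Z z
    drop-e f∈ with x∈p∩q⁻ (I ∪ ⁅ e ⁆) (Z z) f∈
    ... | f∈I∪e , f∈Z with x∈p∪q⁻ I ⁅ e ⁆ f∈I∪e
    ...   | inj₁ f∈I = x∈p∩q⁺ (f∈I , f∈Z)
    ...   | inj₂ f∈e = contradiction (subst (_∈ Z z) (x∈⁅y⁆⇒x≡y e f∈e) f∈Z) e∉Z
  ...   | yes e∈Z = z , ≤-antisym (bound indI z) (≤-pred (≤-trans (≰⇒> exceeds)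
            (+-monoˡ-≤ (d z) (≤-trans (p⊆q⇒∣p∣≤∣q∣ add-e) (∣p∪⁅x⁆∣≤1+∣p∣ (I ∩ Z z) e))))) , e∈Z
    where
    add-e : (I ∪ ⁅ e ⁆) ∩ Z z ⊆ (I ∩ Z z) ∪ ⁅ e ⁆
    add-e f∈ with x∈p∩q⁻ (I ∪ ⁅ e ⁆) (Z z) f∈
    ... | f∈I∪e , f∈Z with x∈p∪q⁻ I ⁅ e ⁆ f∈I∪e
    ...   | inj₁ f∈I = p⊆p∪q ⁅ e ⁆ (x∈p∩q⁺ (f∈I , f∈Z))
    ...   | inj₂ f∈e = q⊆p∪q (I ∩ Z z) ⁅ e ⁆ f∈e

  -- Bases, augmentation and rank

  Maximal : Subset ground → Subset ground → Set
  Maximal I A = ∀ e → e ∈ A → e ∉ I → ¬ Indep (I ∪ ⁅ e ⁆)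

  -- Each rejected element lies in a tight flat, and all these flats lie in the flat of the greatest
  -- tight element `t`.
  maximal⇒spanned : ∀ {I A} → Indep I → Maximal I A →
                    ∃[ t ] (Tight I t × ∀ e → e ∈ A → e ∉ I → e ∈ Z t)
  maximal⇒spanned {I} indI max
    with closed⇒greatest _∨_ ⊑-trans x≤x∨y y≤x∨y {P = Tight I}
           (λ z → ∣ I ∩ Z z ∣ + d z ℕ.≟ K) (tight-∨ indI) (bot , tight-bot indI) id
  ... | t , tight , top = t , tight , λ e e∈A e∉I →
    let z , tz , e∈Z = dependent⇒tight indI (max e e∈A e∉I) in Z-mono (top z tz) e∈Z

  -- If no element can be added, compare `I` and `J` on both sides of `Z t`: inside, `I` attains the
  -- bound that `J` obeys; outside, every element of `J` is already in `I`.
  augment : ∀ {I J} → Indep I → Indep J → ∣ I ∣ < ∣ J ∣ → ∃[ e ] (e ∈ J × e ∉ I × Indep (I ∪ ⁅ e ⁆))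
  augment {I} {J} indI indJ I<J
    with any? (λ e → e ∈? J ×-dec ¬? (e ∈? I) ×-dec Indep? (I ∪ ⁅ e ⁆))
  ... | yes found = found
  ... | no none with maximal⇒spanned {A = J} indI (λ e e∈J e∉I ind → none (e , e∈J , e∉I , ind))
  ...   | t , tight , span = contradiction I<J (≤⇒≯ (begin
    ∣ J ∣                            ≡⟨ ∣p∣≡∣p∩q∣+∣p∩∁q∣ J (Z t) ⟩
    ∣ J ∩ Z t ∣ + ∣ J ∩ ∁ (Z t) ∣  ≤⟨ +-mono-≤
      (+-cancelʳ-≤ (d t) _ _ (≤-trans (bound indJ t) (≤-reflexive (sym tight)))) (p⊆q⇒∣p∣≤∣q∣ outside-t) ⟩
    ∣ I ∩ Z t ∣ + ∣ I ∩ ∁ (Z t) ∣  ≡⟨ ∣p∣≡∣p∩q∣+∣p∩∁q∣ I (Z t) ⟨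
    ∣ I ∣                            ∎))
    where
    open ≤-Reasoning
    outside-t : J ∩ ∁ (Z t) ⊆ I ∩ ∁ (Z t)
    outside-t {e} e∈ with x∈p∩q⁻ J (∁ (Z t)) e∈
    ... | e∈J , e∈∁Z = x∈p∩q⁺
      (decidable-stable (e ∈? I) (λ e∉I → x∈∁p⇒x∉p e∈∁Z (span e e∈J e∉I)) , e∈∁Z)

  M : Matroid ground
  M = record { Indep = Indep ; indep-empty = indep-empty ; indep-subset = indep-subset ; augment = augment }

  -- The list is processed from its end. A rejected element stays rejected as `I` grows, because
  -- independence passes to subsets.
  greedy : (A : Subset ground) (f : Fin n → Fin ground) →
           ∃[ I ] (I ⊆ A × Indep I × ∀ i → f i ∈ A → f i ∉ I → ¬ Indep (I ∪ ⁅ f i ⁆))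
  greedy {n = zero}  A f = ∅ , (λ e∈ → contradiction e∈ ∉⊥) , indep-empty , λ ()
  greedy {n = suc n} A f with greedy A (f ∘ suc)
  ... | I , I⊆A , indI , max with f zero ∈? A ×-dec Indep? (I ∪ ⁅ f zero ⁆)
  ...   | no stuck = I , I⊆A , indI ,
            λ { zero e∈A _ ind → stuck (e∈A , ind) ; (suc i) → max i }
  ...   | yes (e∈A , ind) = I ∪ ⁅ f zero ⁆ , ∪-lub I⊆A (⁅x⁆⊆p e∈A) , ind ,
            λ { zero _ e∉ _ → e∉ (q⊆p∪q I ⁅ f zero ⁆ (x∈⁅x⁆ (f zero)))
              ; (suc i) g∈A g∉ ind′ → max i g∈A (g∉ ∘ p⊆p∪q ⁅ f zero ⁆)
                  (indep-subset (∪⁅⁆-mono (f (suc i)) (p⊆p∪q ⁅ f zero ⁆)) ind′) }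

  basis : ∀ A → ∃[ I ] (I ⊆ A × Indep I × Maximal I A)
  basis A = greedy A id

  maximal⇒maximum : ∀ {I A} → Indep I → Maximal I A → ∀ J → J ⊆ A → Indep J → ∣ J ∣ ≤ ∣ I ∣
  maximal⇒maximum indI max J J⊆A indJ = ≮⇒≥ λ I<J →
    let e , e∈J , e∉I , ind = augment indI indJ I<J in max e (J⊆A e∈J) e∉I ind

  maximum⇒maximal : ∀ {I A} → I ⊆ A → (∀ J → J ⊆ A → Indep J → ∣ J ∣ ≤ ∣ I ∣) → Maximal I A
  maximum⇒maximal {I} I⊆A max e e∈A e∉I ind =
    <⇒≱ (x∉p⇒∣p∣<∣p∪⁅x⁆∣ e∉I) (max (I ∪ ⁅ e ⁆) (∪-lub I⊆A (⁅x⁆⊆p e∈A)) ind)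

  indep⊆Z : ∀ {I z} → Indep I → I ⊆ Z z → ∣ I ∣ + d z ≤ K
  indep⊆Z {I} {z} indI I⊆Z = ≤-trans
    (+-monoˡ-≤ (d z) (p⊆q⇒∣p∣≤∣q∣ {p = I} λ e∈ → x∈p∩q⁺ (e∈ , I⊆Z e∈))) (bound indI z)

  -- The flat of the top element is the whole ground set, and `d` is positive there.
  indep⇒<K : ∀ {I} → Indep I → ∣ I ∣ < K
  indep⇒<K {I} indI with closed⇒greatest _∨_ ⊑-trans x≤x∨y y≤x∨y {P = λ a → a ≡ a}
                            (λ _ → yes refl) (λ _ _ → refl) (bot , refl) id
  ... | top , _ , ⊑top = ≤-trans
    (≤-trans (≤-reflexive (+-comm 1 ∣ I ∣)) (+-monoʳ-≤ ∣ I ∣ (d-pos top)))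
    (indep⊆Z indI λ {e} _ → Z⁺ (⊑top (block e) refl))

  -- If `z` were not below `t`, no point of its block would lie in `Z t`, so the whole block would
  -- lie in `I ∪ ⁅ e ⁆`, which is too small.
  spanned-above : ∀ {I A t} → Indep I → (∀ e → e ∈ A → e ∉ I → e ∈ Z t) →
                  ∀ z e → Z z ⊆ A ∪ ⁅ e ⁆ → z ⊑ t
  spanned-above {I} {A} {t} indI span z e Z⊆ = decidable-stable (z ⊑? t) λ z⋢t →
    contradiction (indep⇒<K indI) (<⇒≱ (≤-trans
      (block⊆⇒N≤ z λ j → [ (λ p∈A → p⊆p∪q ⁅ e ⁆ (decidable-stable (point z j ∈? I)
                              λ p∉I → z⋢t (point∈Z⁻ j (span _ p∈A p∉I))))
                          , q⊆p∪q I ⁅ e ⁆ ]′ (x∈p∪q⁻ A ⁅ e ⁆ (Z⊆ (point∈Z z j))))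
      (∣p∪⁅x⁆∣≤1+∣p∣ I e)))

  tight⇒K≤ : ∀ I t → Tight I t → K ≤ ∣ I ∣ + d t
  tight⇒K≤ I t tight = ≤-trans (≤-reflexive (sym tight)) (+-monoˡ-≤ (d t) (∣p∩q∣≤∣p∣ I (Z t)))

  -- The source of all lower bounds on rank. The spare element `e` lets `A` be a flat `Z z` with one
  -- element deleted.
  large-basis : ∀ A → ∃[ I ] (I ⊆ A × Indep I ×
                  ∃[ t ] (K ≤ ∣ I ∣ + d t × ∀ z e → Z z ⊆ A ∪ ⁅ e ⁆ → z ⊑ t))
  large-basis A with basis A
  ... | I , I⊆A , indI , max with maximal⇒spanned indI max
  ...   | t , tight , span = I , I⊆A , indI , t , tight⇒K≤ I t tight , spanned-above indI span

  -- Deleting `e` leaves `z` below the spanning element `t`, so `d t ≤ d z` and the rank `K - d z`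
  -- is still reached. This shows both the rank of `Z z` and its cyclicity.
  basis-avoiding : ∀ z e → ∃[ I ] (I ⊆ Z z - e × Indep I × ∣ I ∣ + d z ≡ K)
  basis-avoiding z e = let I , I⊆ , indI , t , K≤ , above = large-basis (Z z - e) in
    I , I⊆ , indI , ≤-antisym
    (indep⊆Z indI (⊆-trans I⊆ (p-x⊆p (Z z) e)))
    (≤-trans K≤ (+-monoʳ-≤ ∣ I ∣ (d-antitone (above z e (p⊆[p-x]∪⁅x⁆ (Z z) e)))))

  -- The cyclic flats of the matroid

  Z-flat : ∀ z → IsFlat M (Z z)
  Z-flat z e e∉Z k ((I₀ , I₀⊆Z , indI₀ , ∣I₀∣≡k) , _) ((I , I⊆A , indI , ∣I∣≡k) , max)
    with maximal⇒spanned {A = Z z ∪ ⁅ e ⁆} indI (maximum⇒maximal I⊆A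
           λ J J⊆A indJ → subst (∣ J ∣ ≤_) (sym ∣I∣≡k) (max J J⊆A indJ))
  ... | t , tight , span = e∉Z (subst (λ w → e ∈ Z w) (sym z≡t)
          (span e (q⊆p∪q (Z z) ⁅ e ⁆ (x∈⁅x⁆ e)) e∉I))
    where
    z⊑t : z ⊑ t
    z⊑t = spanned-above indI span z e (p⊆p∪q ⁅ e ⁆ ∘ p⊆p∪q ⁅ e ⁆)

    ∣I∣+dz≤K : ∣ I ∣ + d z ≤ K
    ∣I∣+dz≤K = subst (λ j → j + d z ≤ K) (trans ∣I₀∣≡k (sym ∣I∣≡k)) (indep⊆Z indI₀ I₀⊆Z)

    -- `I` is as large as an independent subset of `Z z`, so it has at most `K - d z` elements, but
    -- tightness gives at least `K - d t`. Strictness of `d` excludes `t` strictly above `z`.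
    z≡t : z ≡ t
    z≡t = decidable-stable (z Fin.≟ t) λ z≢t → <⇒≱ (d-strict (z⊑t , z≢t))
      (+-cancelˡ-≤ ∣ I ∣ _ _ (≤-trans ∣I∣+dz≤K (tight⇒K≤ I t tight)))

    -- Tightness at `z` places all of `I` inside `Z z`, leaving no room for `e`.
    e∉I : e ∉ I
    e∉I e∈I = <⇒≱
      (p⊂q⇒∣p∣<∣q∣ (p∩q⊆p I (Z z) , e , e∈I , λ e∈ → e∉Z (p∩q⊆q I (Z z) e∈)))
      (+-cancelʳ-≤ (d z) _ _ (≤-trans ∣I∣+dz≤K
        (≤-reflexive (sym (subst (Tight I) (sym z≡t) tight)))))

  Z-cyclic : ∀ z e → ¬ IsIsthmusOfRestriction M (Z z) e
  Z-cyclic z e (e∈Z , drops) = drops ∣ I ∣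
    ((I , ⊆-trans I⊆ (p-x⊆p (Z z) e) , indI , refl) , rank≤)
    ((I , I⊆ , indI , refl) , λ J J⊆ → rank≤ J (⊆-trans J⊆ (p-x⊆p (Z z) e)))
    where
    avoiding = basis-avoiding z e
    I = proj₁ avoiding
    I⊆ = proj₁ (proj₂ avoiding)
    indI = proj₁ (proj₂ (proj₂ avoiding))

    rank≤ : ∀ J → J ⊆ Z z → Indep J → ∣ J ∣ ≤ ∣ I ∣
    rank≤ J J⊆Z indJ = +-cancelʳ-≤ (d z) _ _
      (≤-trans (indep⊆Z indJ J⊆Z) (≤-reflexive (sym (proj₂ (proj₂ (proj₂ avoiding))))))

  -- Take the element `t` spanning a basis of `X`. Elements of `X` outside `Z t` lie in every basis
  -- of `X`, hence are isthmuses; elements of `Z t` outside `X` would not raise the rank of `X`.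
  cyclicFlat⇒Z : ∀ X → IsCyclicFlat M X → ∃[ t ] (Z t ≡ X)
  cyclicFlat⇒Z X (flat , cyclic) with basis X
  ... | I , I⊆X , indI , max with maximal⇒spanned indI max
  ...   | t , tight , span = t , ⊆-antisym Z⊆X X⊆Z
    where
    rankX : ∀ J → J ⊆ X → Indep J → ∣ J ∣ ≤ ∣ I ∣
    rankX = maximal⇒maximum indI max

    ∣J∩Z∣≤∣I∩Z∣ : ∀ {J} → Indep J → ∣ J ∩ Z t ∣ ≤ ∣ I ∩ Z t ∣
    ∣J∩Z∣≤∣I∩Z∣ indJ = +-cancelʳ-≤ (d t) _ _ (≤-trans (bound indJ t) (≤-reflexive (sym tight)))

    X─Z⊆I : ∀ {e} → e ∈ X → e ∉ Z t → e ∈ I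
    X─Z⊆I {e} e∈X e∉Z = decidable-stable (e ∈? I) λ e∉I → e∉Z (span e e∈X e∉I)

    isthmus : ∀ {e} → e ∈ X → e ∉ Z t → IsIsthmusOfRestriction M X e
    isthmus {e} e∈X e∉Z = e∈X , λ { k (_ , maxX) ((J , J⊆ , indJ , ∣J∣≡k) , _) →
      <⇒≱ (begin-strict
        ∣ J ∣                            ≡⟨ ∣p∣≡∣p∩q∣+∣p∩∁q∣ J (Z t) ⟩
        ∣ J ∩ Z t ∣ + ∣ J ∩ ∁ (Z t) ∣  <⟨ +-mono-≤-< (∣J∩Z∣≤∣I∩Z∣ indJ)
          (p⊂q⇒∣p∣<∣q∣ ( (λ f∈ → let f∈J , f∈∁ = x∈p∩q⁻ J (∁ (Z t)) f∈ in
                              x∈p∩q⁺ (X─Z⊆I (p-x⊆p X e (J⊆ f∈J)) (x∈∁p⇒x∉p f∈∁) , f∈∁))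
                          , e , x∈p∩q⁺ (X─Z⊆I e∈X e∉Z , x∉p⇒x∈∁p e∉Z)
                          , λ e∈ → x∉p-x X e (J⊆ (p∩q⊆p J (∁ (Z t)) e∈)))) ⟩
        ∣ I ∩ Z t ∣ + ∣ I ∩ ∁ (Z t) ∣  ≡⟨ ∣p∣≡∣p∩q∣+∣p∩∁q∣ I (Z t) ⟨
        ∣ I ∣                            ∎)
      (subst (∣ I ∣ ≤_) (sym ∣J∣≡k) (maxX I I⊆X indI)) }
      where open ≤-Reasoning

    X⊆Z : X ⊆ Z t
    X⊆Z {e} e∈X = decidable-stable (e ∈? Z t) λ e∉Z → cyclic e (isthmus e∈X e∉Z)

    Z⊆X : Z t ⊆ X
    Z⊆X {e} e∈Z = decidable-stable (e ∈? X) λ e∉X → flat e e∉X ∣ I ∣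
      ((I , I⊆X , indI , refl) , rankX)
      ((I , p⊆p∪q ⁅ e ⁆ ∘ I⊆X , indI , refl) , λ J J⊆ indJ → +-cancelʳ-≤ (d t) _ _
        (≤-trans (indep⊆Z indJ (∪-lub X⊆Z (⁅x⁆⊆p e∈Z) ∘ J⊆)) (tight⇒K≤ I t tight)))

  L≅Z : L ≅Z M
  L≅Z = Z , (λ z → Z-flat z , Z-cyclic z) , cyclicFlat⇒Z , λ z w → mk⇔ Z-mono Z-cancel

  -- Transversal presentations and the Mason-Ingleton inequality

  module Presentation {k : ℕ} (A : Fin k → Subset ground)
    (presents : ∀ I → Indep I ⇔ IsPartialTransversal M A I) where

    Adj : Fin ground → Fin k → Set
    Adj e i = e ∈ A i

    meets? : ∀ F → Decidable (λ i → ∃[ e ] (e ∈ F × Adj e i))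
    meets? F i = any? (λ e → e ∈? F ×-dec e ∈? A i)

    abstract
      nbrs : Subset ground → Subset k
      nbrs F = ⟦ meets? F ⟧

      nbrs⁺ : ∀ {F e i} → e ∈ F → Adj e i → i ∈ nbrs F
      nbrs⁺ {F} e∈F e∈A = ∈⟦⟧⁺ (meets? F) (_ , e∈F , e∈A)

      nbrs⁻ : ∀ {F i} → i ∈ nbrs F → ∃[ e ] (e ∈ F × Adj e i)
      nbrs⁻ {F} = ∈⟦⟧⁻ (meets? F)

    nbrs-mono : ∀ {F G} → F ⊆ G → nbrs F ⊆ nbrs G
    nbrs-mono F⊆G i∈ = let _ , e∈F , e∈A = nbrs⁻ i∈ in nbrs⁺ (F⊆G e∈F) e∈A

    nbrs-∪ : ∀ F G → nbrs (F ∪ G) ⊆ nbrs F ∪ nbrs G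
    nbrs-∪ F G i∈ with nbrs⁻ i∈
    ... | e , e∈ , e∈A with x∈p∪q⁻ F G e∈
    ...   | inj₁ e∈F = p⊆p∪q (nbrs G) (nbrs⁺ e∈F e∈A)
    ...   | inj₂ e∈G = q⊆p∪q (nbrs F) (nbrs G) (nbrs⁺ e∈G e∈A)

    indep⇒≤nbrs : ∀ {I F} → Indep I → I ⊆ F → ∣ I ∣ ≤ ∣ nbrs F ∣
    indep⇒≤nbrs {I} {F} indI I⊆F with Equivalence.to (presents I) indI
    ... | φ , φ∈ , φ-inj = injection⇒∣p∣≤∣q∣ I (nbrs F) φ
      (λ e e∈I → nbrs⁺ (I⊆F e∈I) (φ∈ e e∈I)) φ-inj

    matching⇒indep : ∀ {I} → Matching Adj I → Indep I
    matching⇒indep {I} φ = Equivalence.from (presents I)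
      ((λ e _ → to φ e) , (λ e e∈I → adj φ e∈I) , λ e f e∈I f∈I → inj φ e∈I f∈I)

    indep⇒matching : Fin k → ∀ {I} → Indep I → Matching Adj I
    indep⇒matching i₀ {I} indI with Equivalence.to (presents I) indI
    ... | φ , φ∈ , φ-inj = record { to = to′ ; adj = adj′ ; inj = inj′ }
      where
      extend : ∀ e → Dec (e ∈ I) → Fin k
      extend e (yes e∈I) = φ e e∈I
      -- An arbitrary index off `I`, needed because `to` is total.
      extend e (no _)    = i₀

      to′ : Fin ground → Fin k
      to′ e = extend e (e ∈? I)

      adj′ : ∀ {e} → e ∈ I → Adj e (to′ e)
      adj′ {e} e∈I with e ∈? I
      ... | yes p = φ∈ e p
      ... | no e∉I = contradiction e∈I e∉I

      inj′ : ∀ {e f} → e ∈ I → f ∈ I → to′ e ≡ to′ f → e ≡ f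
      inj′ {e} {f} e∈I f∈I eq with e ∈? I | f ∈? I
      ... | yes p | yes q = φ-inj e f p q eq
      ... | no e∉I | _    = contradiction e∈I e∉I
      ... | _ | no f∉I    = contradiction f∈I f∉I

    -- Cyclicity supplies a basis of `Z z` avoiding any given element, which is what
    -- `cyclic⇒neighbours≤rank` asks for.
    nbrs-Z≤ : ∀ z → ∣ nbrs (Z z) ∣ + d z ≤ K
    nbrs-Z≤ z with nonempty? (nbrs (Z z))
    -- Here no index may exist to serve as the default `i₀`, but the bound reduces to `d z ≤ d bot`.
    ... | no empty = ≤-trans (≤-reflexive (cong (_+ d z)
            (trans (cong ∣_∣ (Empty-unique empty)) (∣⊥∣≡0 k)))) (d-antitone (bot⊑ z))
    ... | yes (i₀ , _) = ≤-trans (+-monoˡ-≤ (d z) nbrs≤r) (≤-reflexive r+dz≡K)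
      where
      avoiding = basis-avoiding z (point z zero)
      r = ∣ proj₁ avoiding ∣
      r+dz≡K = proj₂ (proj₂ (proj₂ avoiding))

      avoid : ∀ e → e ∈ Z z → ∃[ J ] (J ⊆ Z z × e ∉ J × Matching Adj J × ∣ J ∣ ≡ r)
      avoid e _ = let J , J⊆ , indJ , eq = basis-avoiding z e in
        J , ⊆-trans J⊆ (p-x⊆p (Z z) e) , (λ e∈J → x∉p-x (Z z) e (J⊆ e∈J)) ,
        indep⇒matching i₀ indJ , +-cancelʳ-≡ (d z) _ _ (trans eq (sym r+dz≡K))

      nbrs≤r : ∣ nbrs (Z z) ∣ ≤ r
      nbrs≤r = cyclic⇒neighbours≤rank Adj (Z z) (nbrs (Z z)) r nbrs⁻
        (let J , J⊆ , _ , φ , eq = avoid (point z zero) (point∈Z z zero) in J , J⊆ , φ , eq)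
        avoid
        λ J J⊆Z φ → +-cancelʳ-≤ (d z) _ _
          (≤-trans (indep⊆Z (matching⇒indep φ) J⊆Z) (≤-reflexive (sym r+dz≡K)))

    -- A large independent subset of `F` is matched into `nbrs F`. The hypothesis says that `w` is
    -- below the join of the `z` with `Z z ⊆ F`, which covers both a flat and a union of two flats.
    K≤nbrs : ∀ F w → (∀ t → (∀ z → Z z ⊆ F → z ⊑ t) → w ⊑ t) → K ≤ ∣ nbrs F ∣ + d w
    K≤nbrs F w below = let I , I⊆F , indI , t , K≤ , above = large-basis F in
      ≤-trans K≤ (+-mono-≤ (indep⇒≤nbrs indI I⊆F)
        (d-antitone (below t λ z Z⊆F → above z (point w zero) (⊆-trans Z⊆F (p⊆p∪q _)))))

    K≤nbrs-Z : ∀ z → K ≤ ∣ nbrs (Z z) ∣ + d z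
    K≤nbrs-Z z = K≤nbrs (Z z) z λ t above → above z ⊆-refl

    K≤nbrs-∪ : ∀ z w → K ≤ ∣ nbrs (Z z) ∪ nbrs (Z w) ∣ + d (z ∨ w)
    K≤nbrs-∪ z w = ≤-trans
      (K≤nbrs (Z z ∪ Z w) (z ∨ w)
        λ t above → ∨-least (above z (p⊆p∪q (Z w))) (above w (q⊆p∪q (Z z) (Z w))))
      (+-monoˡ-≤ (d (z ∨ w)) (p⊆q⇒∣p∣≤∣q∣ (nbrs-∪ (Z z) (Z w))))

    -- Inclusion-exclusion for the index sets of the three flats. Pairwise unions and the common
    -- part, which contains `nbrs (Z x)`, are bounded below by ranks; the three sets and their union
    -- are bounded above. Ranks being `K - d`, four copies of `K` cancel.
    mason-ingleton : ∀ {x} y₁ y₂ y₃ → x ⊑ y₁ → x ⊑ y₂ → x ⊑ y₃ →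
      d ((y₁ ∨ y₂) ∨ y₃) + (d y₁ + d y₂ + d y₃) ≤ d (y₁ ∨ y₂) + d (y₁ ∨ y₃) + d (y₂ ∨ y₃) + d x
    mason-ingleton {x} y₁ y₂ y₃ x⊑y₁ x⊑y₂ x⊑y₃ = +-cancelˡ-≤ (K + K + K + K) _ _ (begin
      (K + K + K + K) + (d u + (d y₁ + d y₂ + d y₃))
        ≤⟨ +-monoˡ-≤ _ (+-mono-≤ (+-mono-≤ (+-mono-≤ (K≤nbrs-∪ y₁ y₂) (K≤nbrs-∪ y₁ y₃)) (K≤nbrs-∪ y₂ y₃)) K≤∩) ⟩
      ((p₁₂ + d₁₂) + (p₁₃ + d₁₃) + (p₂₃ + d₂₃) + (q + d x)) + (d u + (d y₁ + d y₂ + d y₃))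
        ≡⟨ regroup₁ p₁₂ d₁₂ p₁₃ d₁₃ p₂₃ d₂₃ q (d x) _ ⟩
      (p₁₂ + p₁₃ + p₂₃ + q) + ((d u + (d y₁ + d y₂ + d y₃)) + (d₁₂ + d₁₃ + d₂₃ + d x))
        ≤⟨ +-monoˡ-≤ _ (∪∩-inequality S₁ S₂ S₃) ⟩
      (∣ (S₁ ∪ S₂) ∪ S₃ ∣ + (∣ S₁ ∣ + ∣ S₂ ∣ + ∣ S₃ ∣)) + ((d u + (d y₁ + d y₂ + d y₃)) + (d₁₂ + d₁₃ + d₂₃ + d x))
        ≡⟨ regroup₂ (∣ (S₁ ∪ S₂) ∪ S₃ ∣) (∣ S₁ ∣) (∣ S₂ ∣) (∣ S₃ ∣) (d u) (d y₁) (d y₂) (d y₃) _ ⟩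
      ((∣ (S₁ ∪ S₂) ∪ S₃ ∣ + d u) + (∣ S₁ ∣ + d y₁) + (∣ S₂ ∣ + d y₂) + (∣ S₃ ∣ + d y₃)) + (d₁₂ + d₁₃ + d₂₃ + d x)
        ≤⟨ +-monoˡ-≤ _ (+-mono-≤ (+-mono-≤ (+-mono-≤ ∪≤K (nbrs-Z≤ y₁)) (nbrs-Z≤ y₂)) (nbrs-Z≤ y₃)) ⟩
      (K + K + K + K) + (d₁₂ + d₁₃ + d₂₃ + d x) ∎)
      where
      open ≤-Reasoning
      u = (y₁ ∨ y₂) ∨ y₃
      S₁ = nbrs (Z y₁)
      S₂ = nbrs (Z y₂)
      S₃ = nbrs (Z y₃)
      p₁₂ = ∣ S₁ ∪ S₂ ∣
      p₁₃ = ∣ S₁ ∪ S₃ ∣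
      p₂₃ = ∣ S₂ ∪ S₃ ∣
      q = ∣ (S₁ ∩ S₃) ∩ (S₂ ∩ S₃) ∣
      d₁₂ = d (y₁ ∨ y₂)
      d₁₃ = d (y₁ ∨ y₃)
      d₂₃ = d (y₂ ∨ y₃)

      regroup₁ : ∀ a a′ b b′ c c′ e e′ f →
        ((a + a′) + (b + b′) + (c + c′) + (e + e′)) + f ≡ (a + b + c + e) + (f + (a′ + b′ + c′ + e′))
      regroup₁ = solve-∀

      regroup₂ : ∀ a b c e a′ b′ c′ e′ f →
        (a + (b + c + e)) + ((a′ + (b′ + c′ + e′)) + f) ≡ ((a + a′) + (b + b′) + (c + c′) + (e + e′)) + f
      regroup₂ = solve-∀

      K≤∩ : K ≤ q + d x
      K≤∩ = ≤-trans (K≤nbrs-Z x) (+-monoˡ-≤ (d x) (p⊆q⇒∣p∣≤∣q∣ λ i∈ →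
        x∈p∩q⁺ (x∈p∩q⁺ (nbrs-mono (Z-mono x⊑y₁) i∈ , nbrs-mono (Z-mono x⊑y₃) i∈) ,
                x∈p∩q⁺ (nbrs-mono (Z-mono x⊑y₂) i∈ , nbrs-mono (Z-mono x⊑y₃) i∈))))

      S⊆ : ∀ {z} → z ⊑ u → nbrs (Z z) ⊆ nbrs (Z u)
      S⊆ z⊑u = nbrs-mono (Z-mono z⊑u)

      ∪≤K : ∣ (S₁ ∪ S₂) ∪ S₃ ∣ + d u ≤ K
      ∪≤K = ≤-trans (+-monoˡ-≤ (d u) (p⊆q⇒∣p∣≤∣q∣ (∪-lub
        (∪-lub (S⊆ (⊑-trans (x≤x∨y y₁ y₂) (x≤x∨y (y₁ ∨ y₂) y₃)))
               (S⊆ (⊑-trans (y≤x∨y y₁ y₂) (x≤x∨y (y₁ ∨ y₂) y₃))))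
        (S⊆ (y≤x∨y (y₁ ∨ y₂) y₃))))) (nbrs-Z≤ u)

-- A strictly decreasing exponent adapted to the covers of an element

module Exponent (L : FinLattice) (x : Order.Carrier L) where

  open Order L

  #above : Carrier → ℕ
  #above z = ∣ ⟦ (z ⊏?_) ⟧ ∣

  #above-strict : ∀ {z w} → z ⊏ w → #above w < #above z
  #above-strict {z} {w} z⊏w = p⊂q⇒∣p∣<∣q∣
    ( (λ v∈ → ∈⟦⟧⁺ (z ⊏?_) (⊏-⊑-trans z⊏w (proj₁ (∈⟦⟧⁻ (w ⊏?_) v∈))))
    , w , ∈⟦⟧⁺ (z ⊏?_) z⊏w , λ w∈ → proj₂ (∈⟦⟧⁻ (w ⊏?_) w∈) refl)

  #above≤size : ∀ z → #above z ≤ size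
  #above≤size z = ∣p∣≤n ⟦ (z ⊏?_) ⟧

  data Position (z : Carrier) : Set where
    away   : ¬ (x ⊑ z) → Position z
    base   : x ≡ z → Position z
    cover  : Covers x z → Position z
    beyond : x ⊏ z → ¬ Covers x z → Position z

  covers? : ∀ z → Dec (Covers x z)
  covers? z = x ⊏? z ×-dec ¬? (any? λ w → x ⊏? w ×-dec w ⊏? z)

  position : ∀ z → Position z
  position z with x ⊑? z | x Fin.≟ z | covers? z
  ... | no x⋢z  | _       | _     = away x⋢z
  ... | yes _   | yes x≡z | _     = base x≡z
  ... | yes _   | no _    | yes c = cover c
  ... | yes x⊑z | no x≢z  | no ¬c = beyond (x⊑z , x≢z) ¬c

  -- Four layers: at most `size` beyond the covers, then `2 + size`, `3 + size`, and at least
  -- `4 + size` away from `x`. The gap of two under the covers makes powers of two drop there by a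
  -- factor of at least four.
  level : ∀ {z} → Position z → ℕ
  level {z} (away _)     = 4 + (size + #above z)
  level     (base _)     = 3 + size
  level     (cover _)    = 2 + size
  level {z} (beyond _ _) = #above z

  level≤3+size+ : ∀ {z n} → x ⊑ z → (p : Position z) → level p ≤ 3 + (size + n)
  level≤3+size+ x⊑z (away x⋢z)   = contradiction x⊑z x⋢z
  level≤3+size+ x⊑z (base _)     = +-monoʳ-≤ 3 (m≤m+n size _)
  level≤3+size+ x⊑z (cover _)    = m≤n⇒m≤1+n (+-monoʳ-≤ 2 (m≤m+n size _))
  level≤3+size+ {z} x⊑z (beyond _ _) = m≤n⇒m≤o+n 3 (m≤n⇒m≤n+o _ (#above≤size z))

  -- Going up, a position can only move along `away`, `base`, `cover`, `beyond`, and two covers are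
  -- never comparable; within the outer layers `#above` decreases.
  level-strict : ∀ {z w} → z ⊏ w → (p : Position z) (q : Position w) → level q < level p
  level-strict z⊏w (away x⋢z) (away _) = +-monoʳ-< 4 (+-monoʳ-< size (#above-strict z⊏w))
  level-strict z⊏w (away x⋢z) q@(base refl) = s≤s (level≤3+size+ ⊑-refl q)
  level-strict z⊏w (away x⋢z) q@(cover c) = s≤s (level≤3+size+ (proj₁ (proj₁ c)) q)
  level-strict z⊏w (away x⋢z) q@(beyond x⊏w _) = s≤s (level≤3+size+ (proj₁ x⊏w) q)
  level-strict z⊏w (base refl) (away x⋢w) = contradiction (proj₁ z⊏w) x⋢w
  level-strict z⊏w (base refl) (base x≡w) = contradiction x≡w (proj₂ z⊏w)
  level-strict z⊏w (base refl) (cover _) = ≤-refl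
  level-strict {w = w} z⊏w (base refl) (beyond _ _) = s≤s (≤-trans (#above≤size w) (m≤n+m size 2))
  level-strict z⊏w (cover c) (away x⋢w) = contradiction (⊑-trans (proj₁ (proj₁ c)) (proj₁ z⊏w)) x⋢w
  level-strict z⊏w (cover c) (base refl) = contradiction refl (proj₂ (⊏-⊑-trans (proj₁ c) (proj₁ z⊏w)))
  level-strict z⊏w (cover c) (cover (_ , none)) = contradiction (_ , proj₁ c , z⊏w) none
  level-strict {w = w} z⊏w (cover c) (beyond _ _) = s≤s (≤-trans (#above≤size w) (n≤1+n size))
  level-strict z⊏w (beyond x⊏z _) (away x⋢w) = contradiction (⊑-trans (proj₁ x⊏z) (proj₁ z⊏w)) x⋢w
  level-strict z⊏w (beyond x⊏z _) (base refl) = contradiction refl (proj₂ (⊏-⊑-trans x⊏z (proj₁ z⊏w)))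
  level-strict z⊏w (beyond x⊏z _) (cover (_ , none)) = contradiction (_ , x⊏z , z⊏w) none
  level-strict z⊏w (beyond _ _) (beyond _ _) = #above-strict z⊏w

  exponent : Carrier → ℕ
  exponent z = level (position z)

  exponent-strict : ∀ {z w} → z ⊏ w → exponent w < exponent z
  exponent-strict {z} {w} z⊏w = level-strict z⊏w (position z) (position w)

  exponent-base : exponent x ≡ 3 + size
  exponent-base with position x
  ... | away x⋢x            = contradiction ⊑-refl x⋢x
  ... | base _              = refl
  ... | cover ((_ , x≢x) , _) = contradiction refl x≢x
  ... | beyond (_ , x≢x) _  = contradiction refl x≢x

  exponent-cover : ∀ {y} → Covers x y → exponent y ≡ 2 + size
  exponent-cover {y} c with position y
  ... | away x⋢y    = contradiction (proj₁ (proj₁ c)) x⋢y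
  ... | base x≡y    = contradiction x≡y (proj₂ (proj₁ c))
  ... | cover _     = refl
  ... | beyond _ ¬c = contradiction c ¬c

  exponent-beyond : ∀ {w z} → x ⊏ w → w ⊏ z → exponent z ≤ size
  exponent-beyond {w} {z} x⊏w w⊏z with position z
  ... | away x⋢z         = contradiction (⊑-trans (proj₁ x⊏w) (proj₁ w⊏z)) x⋢z
  ... | base refl        = contradiction refl (proj₂ (⊏-⊑-trans x⊏w (proj₁ w⊏z)))
  ... | cover (_ , none) = contradiction (w , x⊏w , w⊏z) none
  ... | beyond _ _       = #above≤size z

  -- If the join were `y`, then `y′` would lie strictly between `x` and `y`.
  ⊏-∨-covers : ∀ {y y′} → Covers x y → Covers x y′ → y ≢ y′ → y ⊏ (y ∨ y′)
  ⊏-∨-covers {y} {y′} (x⊏y , none) (x⊏y′ , none′) y≢y′ = x≤x∨y y y′ , λ eq →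
    none (y′ , x⊏y′ , subst (y′ ⊑_) (sym eq) (y≤x∨y y y′) , y≢y′ ∘ sym)

-- Supermodularity of powers of two and the contradiction

module _ (L : FinLattice) where

  open Order L

  -- Comparable elements give equality. Otherwise the meet is strictly below both, so its power is
  -- at least twice each of theirs and already bounds their sum.
  2^-supermodular : (f : Carrier → ℕ) → (∀ {z w} → z ⊏ w → f w < f z) →
                    ∀ z w → 2 ^ f z + 2 ^ f w ≤ 2 ^ f (z ∧ w) + 2 ^ f (z ∨ w)
  2^-supermodular f f-strict z w with z ⊑? w | w ⊑? z
  ... | yes z⊑w | _ = ≤-reflexive (cong₂ (λ a b → 2 ^ f a + 2 ^ f b)
          (⊑-antisym (∧-greatest ⊑-refl z⊑w) (x∧y≤x z w))
          (⊑-antisym (y≤x∨y z w) (∨-least z⊑w ⊑-refl)))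
  ... | no _ | yes w⊑z = ≤-reflexive (trans (+-comm (2 ^ f z) (2 ^ f w))
          (cong₂ (λ a b → 2 ^ f a + 2 ^ f b)
            (⊑-antisym (∧-greatest w⊑z ⊑-refl) (x∧y≤y z w))
            (⊑-antisym (x≤x∨y z w) (∨-least ⊑-refl w⊑z))))
  ... | no z⋢w | no w⋢z = m≤n⇒m≤n+o _ (half+half≤ (2 ^ f z) (2 ^ f w)
          (^-monoʳ-≤ 2 (f-strict (x∧y≤x z w , λ eq → z⋢w (subst (_⊑ w) eq (x∧y≤y z w)))))
          (^-monoʳ-≤ 2 (f-strict (x∧y≤y z w , λ eq → w⋢z (subst (_⊑ z) eq (x∧y≤x z w))))))
    where
    half+half≤ : ∀ a b {c} → 2 * a ≤ c → 2 * b ≤ c → a + b ≤ c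
    half+half≤ a b 2a≤c 2b≤c with ≤-total a b
    ... | inj₁ a≤b = ≤-trans (+-mono-≤ a≤b (m≤m+n b 0)) 2b≤c
    ... | inj₂ b≤a = ≤-trans (+-monoʳ-≤ a (≤-trans b≤a (m≤m+n a 0))) 2a≤c

  three-covers⇒¬Tr : IsTrLattice L → ∀ {x y₁ y₂ y₃} →
    Covers x y₁ → Covers x y₂ → Covers x y₃ → y₁ ≢ y₂ → y₁ ≢ y₃ → y₂ ≢ y₃ → ⊥
  three-covers⇒¬Tr Tr {x} {y₁} {y₂} {y₃} c₁ c₂ c₃ y₁≢y₂ y₁≢y₃ y₂≢y₃ = <⇒≱ 11P<12P (begin
    12 * P                                              ≡⟨ twelve P ⟩
    2 * (2 * P) + 2 * (2 * P) + 2 * (2 * P)             ≡⟨ cong₂ _+_ (cong₂ _+_ (d-cover c₁) (d-cover c₂)) (d-cover c₃) ⟨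
    d y₁ + d y₂ + d y₃                                  ≤⟨ m≤n+m _ (d ((y₁ ∨ y₂) ∨ y₃)) ⟩
    d ((y₁ ∨ y₂) ∨ y₃) + (d y₁ + d y₂ + d y₃)           ≤⟨ C.Presentation.mason-ingleton A presents y₁ y₂ y₃ (below c₁) (below c₂) (below c₃) ⟩
    d (y₁ ∨ y₂) + d (y₁ ∨ y₃) + d (y₂ ∨ y₃) + d x       ≤⟨ +-mono-≤ (+-mono-≤ (+-mono-≤
                                                             (d-join c₁ c₂ y₁≢y₂) (d-join c₁ c₃ y₁≢y₃)) (d-join c₂ c₃ y₂≢y₃))
                                                             (≤-reflexive (cong (2 ^_) exponent-base)) ⟩
    P + P + P + 2 * (2 * (2 * P))                       ≡⟨ eleven P ⟩
    11 * P                                              ∎)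
    where
    open ≤-Reasoning
    open Exponent L x
    -- In units of `P`, `d` is 8 at `x`, 4 at each cover and at most 1 at a join of two distinct
    -- covers, so the inequality would force 12 to be at most 8 + 3.
    P = 2 ^ size

    d : Carrier → ℕ
    d z = 2 ^ exponent z

    d-strict : ∀ {z w} → z ⊏ w → d w < d z
    d-strict z⊏w = ^-monoʳ-< 2 (s≤s (s≤s z≤n)) (exponent-strict z⊏w)

    d-pos : ∀ z → 0 < d z
    d-pos z = m^n>0 2 (exponent z)

    module C = Construction L d (2^-supermodular exponent exponent-strict) d-strict d-pos
                 (proj₁ (minimum x)) (proj₂ (minimum x))

    transversal = Tr C.ground C.M C.L≅Z
    A = proj₁ (proj₂ transversal)
    presents = proj₂ (proj₂ transversal)

    below : ∀ {y} → Covers x y → x ⊑ y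
    below c = proj₁ (proj₁ c)

    d-cover : ∀ {y} → Covers x y → d y ≡ 2 * (2 * P)
    d-cover c = cong (2 ^_) (exponent-cover c)

    d-join : ∀ {y y′} → Covers x y → Covers x y′ → y ≢ y′ → d (y ∨ y′) ≤ P
    d-join c c′ y≢y′ = ^-monoʳ-≤ 2 (exponent-beyond (proj₁ c) (⊏-∨-covers c c′ y≢y′))

    11P<12P : 11 * P < 12 * P
    11P<12P = *-monoˡ-< P {{m^n≢0 2 size}} (≤-refl {12})

    twelve : ∀ P → 12 * P ≡ 2 * (2 * P) + 2 * (2 * P) + 2 * (2 * P)
    twelve = solve-∀

    eleven : ∀ P → P + P + P + 2 * (2 * (2 * P)) ≡ 11 * P
    eleven = solve-∀

theorem4p1 : (L : FinLattice) → IsTrLattice L →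
    ∀ x y₁ y₂ y₃ → FinLattice.Covers L x y₁ → FinLattice.Covers L x y₂ → FinLattice.Covers L x y₃ →
    (y₁ ≡ y₂) ⊎ (y₁ ≡ y₃) ⊎ (y₂ ≡ y₃)
theorem4p1 L Tr x y₁ y₂ y₃ c₁ c₂ c₃ with y₁ Fin.≟ y₂ | y₁ Fin.≟ y₃ | y₂ Fin.≟ y₃
... | yes y₁≡y₂ | _         | _         = inj₁ y₁≡y₂
... | no _      | yes y₁≡y₃ | _         = inj₂ (inj₁ y₁≡y₃)
... | no _      | no _      | yes y₂≡y₃ = inj₂ (inj₂ y₂≡y₃)
... | no y₁≢y₂  | no y₁≢y₃  | no y₂≢y₃  = 
  ⊥-elim (three-covers⇒¬Tr L Tr c₁ c₂ c₃ y₁≢y₂ y₁≢y₃ y₂≢y₃)
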